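{- Let $Q(x,y,z)=ax^2+by^2+cz^2$, where $a,b,c$ are positive integers with $\gcd(a,b,c)=1$. For each prime $p$, the coefficients are labeled according to the labeling convention given in the context. Then the following hold. For an odd prime $p$, with $\left(\frac{\cdot}{p}\right)$ the Legendre symbol, \[ \epsilon_{Q,p}=\begin{cases}1 & \text{if }p\text{ divides exactly two of the integers }a,b,c,\\ 2 & \text{if }p\text{ divides exactly one of the integers }a,b,c\text{ and }\left(\frac{ -bc}{p}\right)=-1,\\ \infty & \text{if }p\nmid abc,\text{ or }p\text{ divides exactly one of the integers }a,b,c\text{ and }\left(\frac{ -bc}{p}\right)=1.\end{cases} \] For $p=2$: (1) If all of $a,b,c$ are odd, \[ \epsilon_{Q,2}=\begin{cases}3 & \text{if }a\equiv b\equiv c\pmod4,\\ \infty & \text{otherwise}.\end{cases} \] (2) If $a,b$ are even and $c$ is odd, \[ \epsilon_{Q,2}=\begin{cases}2 & \text{if }4\mid a\text{ and }4\mid b,\\ 3 & \text{if }a\equiv b\equiv2\pmod4,\text{ or }a\equiv2\pmod4\text{ and }b\equiv0\pmod8,\\ 4 & \text{if }a\equiv2\pmod4\text{ and }b\equiv4\pmod8.\end{cases} \] (3) If $a$ is even and $b,c$ are odd, \[ \epsilon_{Q,2}=\begin{cases}2 & \text{if }4\mid a,\\ \infty & \text{if }a\equiv2\pmod4\text{ and }a+b+c\equiv0\pmod8,\text{ or }a\equiv2\pmod4\text{ and }b+c\equiv0\pmod8,\\ 4 & \text{otherwise}.\end{cases} \]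
   Context: For $l\in\mathbb{Z}$ and $k\in\mathbb{Z}_{\ge1}$, write $Q\not\equiv l\pmod k$ if $Q(x,y,z)\not\equiv l\pmod k$ for all $(x,y,z)\in\mathbb{Z}^3$. We say $Q$ has a local obstruction modulo $k$ if there exists $l\in\mathbb{Z}$ with $Q\not\equiv l\pmod k$. For a prime $p$, $\epsilon_{Q,p}:=\min\{e\in\mathbb{Z}_{\ge1}\mid Q\text{ has a local obstruction modulo }p^e\}$, with $\epsilon_{Q,p}=\infty$ if $Q$ has no local obstruction modulo $p^e$ for any $e$. Labeling convention (permuting the variables does not change $\epsilon_{Q,p}$): for an odd prime $p$ dividing exactly one of the coefficients, the coefficients are labeled so that $p\mid a$. For $p=2$: if exactly two coefficients are even they are labeled $a,b$, ordered so that $a\equiv2\pmod4$ whenever exactly one of them is $\equiv2\pmod4$; if exactly one coefficient is even it is called $a$. With this convention the case distinctions are exhaustive. -}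

module Defs where

open import Data.Bool.Base using (if_then_else_)
open import Data.Fin.Base using (Fin; toℕ; fromℕ<)
open import Data.Fin.Properties using (any?; toℕ-fromℕ<)
open import Data.Integer.Base
  using (ℤ; +_; -_; _+_; _-_; _*_; 0ℤ; 1ℤ; -1ℤ)
open import Data.Integer.DivMod using (_%ℕ_; _/ℕ_; n%ℕd<d; a≡a%ℕn+[a/ℕn]*n)
open import Data.Integer.Divisibility.Signed
  using (_∣_; _∣?_; ∣-refl; ∣m∣n⇒∣m-n; ∣n⇒∣m*n)
open import Data.Integer.Tactic.RingSolver using (solve-∀)
open import Data.Nat.Base using (ℕ; NonZero; _≤_; _^_)
open import Data.Nat.Primality using (Prime; prime⇒nonZero)
open import Data.Product.Base using (_×_; _,_; ∃)
open import Data.Vec.Base using (Vec; []; _∷_; count)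
open import Relation.Binary.PropositionalEquality
  using (_≡_; sym; subst)
open import Relation.Nullary.Construct.Add.Supremum using (_⁺; [_]; ⊤⁺)
open import Relation.Nullary.Decidable using (Dec; does; map′)
open import Relation.Nullary.Negation using (¬_)

infix 4 _≡_[mod_] _≡_[mod_]?

_≡_[mod_] : ℤ → ℤ → ℕ → Set
m ≡ n [mod k ] = + k ∣ m - n

_≡_[mod_]? : (m n : ℤ) (k : ℕ) → Dec (m ≡ n [mod k ])
m ≡ n [mod k ]? = + k ∣? m - n

TernaryForm : Set
TernaryForm = ℤ → ℤ → ℤ → ℤ

diagonal : ℤ → ℤ → ℤ → TernaryForm
diagonal a b c x y z = a * (x * x) + b * (y * y) + c * (z * z)

NeverCongruent : TernaryForm → ℤ → ℕ → Set
NeverCongruent Q l k = ∀ x y z → ¬ (Q x y z ≡ l [mod k ])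

LocalObstruction : TernaryForm → ℕ → Set
LocalObstruction Q k = ∃ λ l → NeverCongruent Q l k

ObstructionAt : TernaryForm → ℕ → ℕ → Set
ObstructionAt Q p e = 1 ≤ e × LocalObstruction Q (p ^ e)

ℕ∞ : Set
ℕ∞ = ℕ ⁺

pattern ∞ = ⊤⁺

-- IsEpsilon Q p v says that ε_{Q,p} = v.  The value is given by its graph,
-- because deciding between a finite minimum and ∞ is not constructive a priori.
IsEpsilon : TernaryForm → ℕ → ℕ∞ → Set
IsEpsilon Q p [ e ] = ObstructionAt Q p e × (∀ f → ObstructionAt Q p f → e ≤ f)
IsEpsilon Q p ∞     = ∀ e → ¬ ObstructionAt Q p e

QuadraticResidue : ℤ → ℕ → Set
QuadraticResidue n p = ∃ λ x → x * x ≡ n [mod p ]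

quadraticResidue? : ∀ n p .⦃ _ : NonZero p ⦄ → Dec (QuadraticResidue n p)
quadraticResidue? n p = map′ to from (any? square?)
  where
  SquareOf : Fin p → Set
  SquareOf r = + toℕ r * + toℕ r ≡ n [mod p ]

  square? : ∀ r → Dec (SquareOf r)
  square? r = + toℕ r * + toℕ r ≡ n [mod p ]?

  to : ∃ SquareOf → QuadraticResidue n p
  to (r , eq) = + toℕ r , eq

  expand : ∀ r q d m → ((r + q * d) * (r + q * d) - m) - (q * (r + r + q * d)) * d
                       ≡ r * r - m
  expand = solve-∀

  from : QuadraticResidue n p → ∃ SquareOf
  from (x , eq) = fromℕ< (n%ℕd<d x p) ,
    subst (λ r → + r * + r ≡ n [mod p ]) (sym (toℕ-fromℕ< (n%ℕd<d x p)))
      (subst (+ p ∣_) (expand (+ (x %ℕ p)) (x /ℕ p) (+ p) n)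
        (∣m∣n⇒∣m-n
          (subst (λ y → + p ∣ y * y - n) (a≡a%ℕn+[a/ℕn]*n x p) eq)
          (∣n⇒∣m*n ((x /ℕ p) * (+ (x %ℕ p) + + (x %ℕ p) + (x /ℕ p) * + p)) ∣-refl)))

-- The Legendre symbol (n / p); only meaningful for odd p.
legendre : ℤ → (p : ℕ) → Prime p → ℤ
legendre n p p-prime =
  if does (+ p ∣? n) then 0ℤ
  else if does (quadraticResidue? n p ⦃ prime⇒nonZero p-prime ⦄) then 1ℤ
  else -1ℤ

#divisibleBy : ∀ {n} → ℕ → Vec ℤ n → ℕ
#divisibleBy p = count (+ p ∣?_)

-- A normalisation of the order of a, b, c relative to the prime p, not a
-- restriction: every triple can be permuted so as to satisfy it.
record Labelled (p : ℕ) (a b c : ℤ) : Set where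
  field
    one-divisible : #divisibleBy p (a ∷ b ∷ c ∷ []) ≡ 1 → + p ∣ a
    two-even      : p ≡ 2 → #divisibleBy 2 (a ∷ b ∷ c ∷ []) ≡ 2 →
                    + 2 ∣ a × + 2 ∣ b
    two-even-order : p ≡ 2 → #divisibleBy 2 (a ∷ b ∷ c ∷ []) ≡ 2 →
                     count (_≡ + 2 [mod 4 ]?) (a ∷ b ∷ []) ≡ 1 →
                     a ≡ + 2 [mod 4 ]

{-# OPTIONS --safe #-}
-- A finite value ε = m + 1 means an obstruction modulo p^(m+1) together with universality modulo p^m,
-- and ε = ∞ means universality modulo every p^n.
--
-- Odd p.  If p ∤ bc, pigeonhole makes by² + cz² universal modulo p; a solution in which one of ax, by, cz
-- is a unit lifts to every p^n by Hensel.  If p ∣ a and −bc is not a square, p ∣ by² + cz² forces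
-- p ∣ y, z, so a multiple of p represented modulo p² is of the form ax²; as w ↦ dw² is never onto
-- modulo p, some multiple of p is missed.
--
-- p = 2.  The finite values depend on a, b, c modulo 16 only and are found by enumeration.  If 4 divides
-- none of a, b, c, universality modulo 16 gives universality modulo 2^n: for 4 ∤ l some variable is odd and
-- Hensel applies, and for l = 4m one doubles a solution for m.
module Submission where

open import Defs
open import Data.Bool.Base using (if_then_else_)
open import Data.Fin.Base using (Fin; toℕ; fromℕ<; splitAt; join)
open import Data.Fin.Patterns using (0F; 1F; 2F)
open import Data.Fin.Properties
  using (all?; any?; toℕ<n; toℕ-fromℕ<; toℕ-injective; <⇒≢; join-splitAt; pigeonhole; ¬∀⟶∃¬)
open import Data.Integer.Base as ℤ using (ℤ; +_; -_; _+_; _-_; _*_; 0ℤ; 1ℤ; -1ℤ; Positive)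
open import Data.Integer.DivMod using (_%ℕ_; _/ℕ_; n%ℕd<d; a≡a%ℕn+[a/ℕn]*n)
open import Data.Integer.Divisibility.Signed
open import Data.Integer.GCD using (gcd)
open import Data.Integer.Properties
  using (pos-*; abs-*; m-n≡m⊖n; ⊖-≥; *-comm; *-zeroʳ; *-identityʳ; +-identityˡ)
open import Data.Integer.Tactic.RingSolver using (solve-∀)
open import Data.Nat.Base as ℕ using (ℕ; zero; suc; NonZero; _^_)
open import Data.Nat.Coprimality using (Coprime; prime⇒coprime; coprime-Bézout)
import Data.Nat.Divisibility as ℕ
import Data.Nat.DivMod as ℕ
open import Data.Nat.GCD using (module Bézout)
open import Data.Nat.Primality
  using (Prime; euclidsLemma; prime⇒nonZero; prime⇒nonTrivial; prime⇒irreducible; prime[2])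
import Data.Nat.Properties as ℕ
open import Data.Product.Base using (_×_; _,_; ∃; proj₁; proj₂; map₂)
open import Data.Sum.Base as Sum using (_⊎_; inj₁; inj₂; [_,_]′)
open import Data.Vec.Base using (Vec; []; _∷_; lookup)
open import Function.Base using (_∘_; id)
open import Relation.Binary.Definitions using (tri<; tri≈; tri>)
open import Relation.Binary.PropositionalEquality
  using (_≡_; _≢_; refl; sym; trans; cong; cong₂; subst)
open import Relation.Nullary.Construct.Add.Supremum using ([_])
open import Relation.Nullary.Decidable
  using (Dec; does; yes; no; True; toWitness; from-no; _×-dec_; _⊎-dec_; _→-dec_; ¬?)
open import Relation.Nullary.Negation using (¬_; contradiction)

-- Congruences modulo k

mod-refl : ∀ m {k} → m ≡ m [mod k ]
mod-refl m = divides 0ℤ (cancel m)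
  where
  cancel : ∀ m → m - m ≡ 0ℤ
  cancel = solve-∀

mod-sym : ∀ m n {k} → m ≡ n [mod k ] → n ≡ m [mod k ]
mod-sym m n = subst (_ ∣_) (negate m n) ∘ ∣m⇒∣-m
  where
  negate : ∀ m n → - (m - n) ≡ n - m
  negate = solve-∀

mod-trans : ∀ l m n {k} → l ≡ m [mod k ] → m ≡ n [mod k ] → l ≡ n [mod k ]
mod-trans l m n l≡m m≡n = subst (_ ∣_) (telescope l m n) (∣m∣n⇒∣m+n l≡m m≡n)
  where
  telescope : ∀ l m n → (l - m) + (m - n) ≡ l - n
  telescope = solve-∀

mod-+ : ∀ m m′ n n′ {k} → m ≡ m′ [mod k ] → n ≡ n′ [mod k ] →
        m + n ≡ m′ + n′ [mod k ]
mod-+ m m′ n n′ m≡m′ n≡n′ = subst (_ ∣_) (regroup m m′ n n′) (∣m∣n⇒∣m+n m≡m′ n≡n′)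
  where
  regroup : ∀ m m′ n n′ → (m - m′) + (n - n′) ≡ (m + n) - (m′ + n′)
  regroup = solve-∀

mod-neg : ∀ m m′ {k} → m ≡ m′ [mod k ] → - m ≡ - m′ [mod k ]
mod-neg m m′ = subst (_ ∣_) (negate m m′) ∘ ∣m⇒∣-m
  where
  negate : ∀ m m′ → - (m - m′) ≡ - m - - m′
  negate = solve-∀

mod-* : ∀ m m′ n n′ {k} → m ≡ m′ [mod k ] → n ≡ n′ [mod k ] →
        m * n ≡ m′ * n′ [mod k ]
mod-* m m′ n n′ m≡m′ n≡n′ = subst (_ ∣_) (regroup m m′ n n′)
  (∣m∣n⇒∣m+n (∣m⇒∣m*n n m≡m′) (∣n⇒∣m*n m′ n≡n′))
  where
  regroup : ∀ m m′ n n′ → (m - m′) * n + m′ * (n - n′) ≡ m * n - m′ * n′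
  regroup = solve-∀

pos-∣ : ∀ {j k} → j ℕ.∣ k → + j ∣ + k
pos-∣ = ∣ᵤ⇒∣

mod-weaken : ∀ m n {j k} → j ℕ.∣ k → m ≡ n [mod k ] → m ≡ n [mod j ]
mod-weaken _ _ j∣k = ∣-trans (pos-∣ j∣k)

mod-resp-∣ : ∀ m n {j k} → j ℕ.∣ k → m ≡ n [mod k ] → + j ∣ m → + j ∣ n
mod-resp-∣ m n j∣k m≡n j∣m = subst (_ ∣_) (cancel m n)
  (∣m∣n⇒∣m-n j∣m (mod-weaken m n j∣k m≡n))
  where
  cancel : ∀ m n → m - (m - n) ≡ n
  cancel = solve-∀

mod-residue : ∀ x k .⦃ _ : NonZero k ⦄ → ∃ λ (r : Fin k) → x ≡ + toℕ r [mod k ]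
mod-residue x k = fromℕ< (n%ℕd<d x k) ,
  subst (λ r → x ≡ + r [mod k ]) (sym (toℕ-fromℕ< (n%ℕd<d x k)))
    (divides (x /ℕ k) (trans (cong (_- + (x %ℕ k)) (a≡a%ℕn+[a/ℕn]*n x k))
                             (cancel (+ (x %ℕ k)) (x /ℕ k) (+ k))))
  where
  cancel : ∀ r q k → r + q * k - r ≡ q * k
  cancel = solve-∀

^-mono-∣ : ∀ p {m n} → m ℕ.≤ n → p ^ m ℕ.∣ p ^ n
^-mono-∣ p {m} {n} m≤n = ℕ.divides (p ^ (n ℕ.∸ m))
  (trans (cong (p ^_) (sym (ℕ.m∸n+n≡m m≤n))) (ℕ.^-distribˡ-+-* p (n ℕ.∸ m) m))

-- Universality modulo k and the value of ε

Represents : TernaryForm → ℤ → ℕ → Set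
Represents Q l k = ∃ λ x → ∃ λ y → ∃ λ z → Q x y z ≡ l [mod k ]

Universal : TernaryForm → ℕ → Set
Universal Q k = ∀ l → Represents Q l k

represents-weaken : ∀ Q l {j k} → j ℕ.∣ k → Represents Q l k → Represents Q l j
represents-weaken Q l j∣k (x , y , z , eq) =
  x , y , z , mod-weaken (Q x y z) l j∣k eq

universal⇒unobstructed : ∀ Q {k} → Universal Q k → ¬ LocalObstruction Q k
universal⇒unobstructed Q univ (l , never) with x , y , z , eq ← univ l = never x y z eq

-- A representation modulo p^m reduces to one modulo p^f for every f ≤ m, so universality at m alone
-- excludes all smaller exponents.
isEpsilon-suc : ∀ Q p m → LocalObstruction Q (p ^ suc m) → Universal Q (p ^ m) →
                IsEpsilon Q p [ suc m ]
isEpsilon-suc Q p m obs univ = (ℕ.s≤s ℕ.z≤n , obs) , minimal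
  where
  minimal : ∀ f → ObstructionAt Q p f → suc m ℕ.≤ f
  minimal f (_ , obsᶠ) = ℕ.≰⇒> λ f≤m →
    universal⇒unobstructed Q
      (λ l → represents-weaken Q l (^-mono-∣ p f≤m) (univ l)) obsᶠ

isEpsilon-∞ : ∀ Q {p} → (∀ e → Universal Q (p ^ e)) → IsEpsilon Q p ∞
isEpsilon-∞ Q univ e (_ , obs) = universal⇒unobstructed Q (univ e) obs

-- The variables enter through congruent squares, not congruent values, so that `square-mod-16` can
-- put one of 0, 1, 2, 3 in place of any integer.
diagonal-cong : ∀ a a′ b b′ c c′ x x′ y y′ z z′ {k} →
  a ≡ a′ [mod k ] → b ≡ b′ [mod k ] → c ≡ c′ [mod k ] →
  x * x ≡ x′ * x′ [mod k ] → y * y ≡ y′ * y′ [mod k ] → z * z ≡ z′ * z′ [mod k ] →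
  diagonal a b c x y z ≡ diagonal a′ b′ c′ x′ y′ z′ [mod k ]
diagonal-cong a a′ b b′ c c′ x x′ y y′ z z′ a≡ b≡ c≡ x≡ y≡ z≡ =
  mod-+ (a * (x * x) + b * (y * y)) (a′ * (x′ * x′) + b′ * (y′ * y′))
        (c * (z * z)) (c′ * (z′ * z′))
    (mod-+ (a * (x * x)) (a′ * (x′ * x′)) (b * (y * y)) (b′ * (y′ * y′))
      (mod-* a a′ (x * x) (x′ * x′) a≡ x≡)
      (mod-* b b′ (y * y) (y′ * y′) b≡ y≡))
    (mod-* c c′ (z * z) (z′ * z′) c≡ z≡)

-- Finite checks on residues modulo powers of two

-- The squares modulo 16 are 0, 1, 4 and 9. This cuts the later enumerations to 4³ triples of
-- variables.
square-mod-16 : ∀ x → ∃ λ (r : Fin 4) → x * x ≡ + toℕ r * + toℕ r [mod 16 ]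
square-mod-16 x =
  let r , x≡r   = mod-residue x 16
      s , r²≡s² = small r
  in s , mod-trans (x * x) (+ toℕ r * + toℕ r) (+ toℕ s * + toℕ s)
           (mod-* x (+ toℕ r) x (+ toℕ r) x≡r x≡r) r²≡s²
  where
  small : ∀ (r : Fin 16) → ∃ λ (s : Fin 4) → + toℕ r * + toℕ r ≡ + toℕ s * + toℕ s [mod 16 ]
  small = toWitness {a? = all? λ r → any? λ s → + toℕ r * + toℕ r ≡ + toℕ s * + toℕ s [mod 16 ]?} _

infix  11 ⊝_
infixl 10 _⊕_ _⊟_
infix  9 _∣ᶠ_
infix  8 ¬ᶠ_
infixr 7 _∧ᶠ_
infixr 6 _∨ᶠ_

-- Conditions on the coefficients are reified so that they can be decided on residues and also
-- transported along congruences. Sums and negations suffice to express the conditions of the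
-- theorem.
data Term : Set where
  var  : Fin 3 → Term
  con  : ℤ → Term
  _⊕_  : Term → Term → Term
  ⊝_   : Term → Term

_⊟_ : Term → Term → Term
s ⊟ t = s ⊕ ⊝ t

𝐚 𝐛 𝐜 : Term
𝐚 = var 0F
𝐛 = var 1F
𝐜 = var 2F

-- Formulas whose truth depends only on the residues modulo k of three variables.
data Formula (k : ℕ) : Set where
  _∣ᶠ_      : (j : ℕ) {j∣k : True (j ℕ.∣? k)} → Term → Formula k
  _∧ᶠ_ _∨ᶠ_ : Formula k → Formula k → Formula k
  ¬ᶠ_       : Formula k → Formula k

eval : Vec ℤ 3 → Term → ℤ
eval ρ (var i) = lookup ρ i
eval ρ (con n) = n
eval ρ (s ⊕ t) = eval ρ s + eval ρ t
eval ρ (⊝ t)   = - eval ρ t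

⟦_⟧ : ∀ {k} → Formula k → Vec ℤ 3 → Set
⟦ j ∣ᶠ t ⟧ ρ = + j ∣ eval ρ t
⟦ φ ∧ᶠ ψ ⟧ ρ = ⟦ φ ⟧ ρ × ⟦ ψ ⟧ ρ
⟦ φ ∨ᶠ ψ ⟧ ρ = ⟦ φ ⟧ ρ ⊎ ⟦ ψ ⟧ ρ
⟦ ¬ᶠ φ ⟧   ρ = ¬ ⟦ φ ⟧ ρ

⟦_⟧? : ∀ {k} (φ : Formula k) ρ → Dec (⟦ φ ⟧ ρ)
⟦ j ∣ᶠ t ⟧? ρ = + j ∣? eval ρ t
⟦ φ ∧ᶠ ψ ⟧? ρ = ⟦ φ ⟧? ρ ×-dec ⟦ ψ ⟧? ρ
⟦ φ ∨ᶠ ψ ⟧? ρ = ⟦ φ ⟧? ρ ⊎-dec ⟦ ψ ⟧? ρ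
⟦ ¬ᶠ φ ⟧?   ρ = ¬? (⟦ φ ⟧? ρ)

eval-cong : ∀ {k ρ σ} → (∀ i → lookup ρ i ≡ lookup σ i [mod k ]) →
            ∀ t → eval ρ t ≡ eval σ t [mod k ]
eval-cong ρ≡σ (var i) = ρ≡σ i
eval-cong ρ≡σ (con n) = mod-refl n
eval-cong ρ≡σ (s ⊕ t) = mod-+ (eval _ s) (eval _ s) (eval _ t) (eval _ t)
                              (eval-cong ρ≡σ s) (eval-cong ρ≡σ t)
eval-cong ρ≡σ (⊝ t)   = mod-neg (eval _ t) (eval _ t) (eval-cong ρ≡σ t)

⟦⟧-cong : ∀ {k ρ σ} (φ : Formula k) → (∀ i → lookup ρ i ≡ lookup σ i [mod k ]) →
          ⟦ φ ⟧ ρ → ⟦ φ ⟧ σ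
⟦⟧-cong (_∣ᶠ_ j {j∣k} t) ρ≡σ j∣t =
  mod-resp-∣ (eval _ t) (eval _ t) (toWitness j∣k) (eval-cong ρ≡σ t) j∣t
⟦⟧-cong (φ ∧ᶠ ψ) ρ≡σ (p , q)  = ⟦⟧-cong φ ρ≡σ p , ⟦⟧-cong ψ ρ≡σ q
⟦⟧-cong (φ ∨ᶠ ψ) ρ≡σ (inj₁ p) = inj₁ (⟦⟧-cong φ ρ≡σ p)
⟦⟧-cong (φ ∨ᶠ ψ) ρ≡σ (inj₂ q) = inj₂ (⟦⟧-cong ψ ρ≡σ q)
⟦⟧-cong {ρ = ρ} {σ} (¬ᶠ φ) ρ≡σ ¬p =
  -- Negation reverses the direction of transport, so the congruences are turned round.
  ¬p ∘ ⟦⟧-cong φ (λ i → mod-sym (lookup ρ i) (lookup σ i) (ρ≡σ i))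

residue : ∀ {k} → Fin k → ℤ
residue r = + toℕ r

residueForm : ∀ {k} (A B C : Fin k) (x y z : Fin 4) → ℤ
residueForm A B C x y z =
  diagonal (residue A) (residue B) (residue C) (residue x) (residue y) (residue z)

Obstructed : ∀ k (A B C : Fin k) → Set
Obstructed k A B C =
  ∃ λ (l : Fin k) → ∀ (x y z : Fin 4) → ¬ (residueForm A B C x y z ≡ residue l [mod k ])

-- The moduli differ because a value ε = m + 1 needs the coefficients modulo k = 2^(m+1) but
-- universality only modulo j = 2^m.
Covered : ∀ j {k} (A B C : Fin k) → Set
Covered j A B C = ∀ (l : Fin j) → ∃ λ (x : Fin 4) → ∃ λ (y : Fin 4) → ∃ λ (z : Fin 4) →
  residueForm A B C x y z ≡ residue l [mod j ]

obstructed? : ∀ k (A B C : Fin k) → Dec (Obstructed k A B C)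
obstructed? k A B C = any? λ l → all? λ x → all? λ y → all? λ z →
  ¬? (residueForm A B C x y z ≡ residue l [mod k ]?)

covered? : ∀ j {k} (A B C : Fin k) → Dec (Covered j A B C)
covered? j A B C = all? λ l → any? λ x → any? λ y → any? λ z →
  residueForm A B C x y z ≡ residue l [mod j ]?

obstructed⇒obstruction : ∀ {k} a b c (A B C : Fin k) → k ℕ.∣ 16 →
  a ≡ residue A [mod k ] → b ≡ residue B [mod k ] → c ≡ residue C [mod k ] →
  Obstructed k A B C → LocalObstruction (diagonal a b c) k
obstructed⇒obstruction {k} a b c A B C k∣16 a≡A b≡B c≡C (l , never) = residue l , obstructed
  where
  SquareResidue : ℤ → Set
  SquareResidue x = ∃ λ (r : Fin 4) → x * x ≡ residue r * residue r [mod k ]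

  square-mod-k : ∀ x → SquareResidue x
  square-mod-k x = map₂ (λ {r} → mod-weaken (x * x) (residue r * residue r) k∣16) (square-mod-16 x)

  refute : ∀ x y z → SquareResidue x → SquareResidue y → SquareResidue z →
           ¬ (diagonal a b c x y z ≡ residue l [mod k ])
  refute x y z (r , x≡r) (s , y≡s) (t , z≡t) Q≡l = never r s t
    (mod-trans (residueForm A B C r s t) (diagonal a b c x y z) (residue l)
      (mod-sym (diagonal a b c x y z) (residueForm A B C r s t)
        (diagonal-cong a (residue A) b (residue B) c (residue C)
          x (residue r) y (residue s) z (residue t) a≡A b≡B c≡C x≡r y≡s z≡t))
      Q≡l)

  obstructed : NeverCongruent (diagonal a b c) (residue l) k
  obstructed x y z = refute x y z (square-mod-k x) (square-mod-k y) (square-mod-k z)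

covered⇒universal : ∀ {j k} .⦃ _ : NonZero j ⦄ a b c (A B C : Fin k) → j ℕ.∣ k →
  a ≡ residue A [mod k ] → b ≡ residue B [mod k ] → c ≡ residue C [mod k ] →
  Covered j A B C → Universal (diagonal a b c) j
covered⇒universal {j} a b c A B C j∣k a≡A b≡B c≡C cover l =
  let L , l≡L = mod-residue l j
      x , y , z , Q≡L = cover L
  in residue x , residue y , residue z ,
     mod-trans (diagonal a b c (residue x) (residue y) (residue z))
               (residueForm A B C x y z) l
       (diagonal-cong a (residue A) b (residue B) c (residue C)
         (residue x) (residue x) (residue y) (residue y) (residue z) (residue z)
         (mod-weaken a (residue A) j∣k a≡A)
         (mod-weaken b (residue B) j∣k b≡B)
         (mod-weaken c (residue C) j∣k c≡C)
         (mod-refl (residue x * residue x)) (mod-refl (residue y * residue y))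
         (mod-refl (residue z * residue z)))
       (mod-trans (residueForm A B C x y z) (residue L) l Q≡L (mod-sym l (residue L) l≡L))

residues : ∀ {k} (A B C : Fin k) → Vec ℤ 3
residues A B C = residue A ∷ residue B ∷ residue C ∷ []

module _ {k} (φ : Formula k) {P : Fin k → Fin k → Fin k → Set}
         (P? : ∀ A B C → Dec (P A B C)) where

  onResidues? : Dec (∀ A B C → ⟦ φ ⟧ (residues A B C) → P A B C)
  onResidues? = all? λ A → all? λ B → all? λ C → ⟦ φ ⟧? (residues A B C) →-dec P? A B C

  -- The truth of `φ` passes from the integers to their residues by `⟦⟧-cong`, and there the
  -- decision over all k³ triples has settled `P`.
  onResidues : .⦃ _ : NonZero k ⦄ → True onResidues? → ∀ a b c → ⟦ φ ⟧ (a ∷ b ∷ c ∷ []) →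
    ∃ λ A → ∃ λ B → ∃ λ C →
      (a ≡ residue A [mod k ]) × (b ≡ residue B [mod k ]) × (c ≡ residue C [mod k ]) × P A B C
  onResidues ok a b c φabc =
    let A , a≡A = mod-residue a k
        B , b≡B = mod-residue b k
        C , c≡C = mod-residue c k
    in A , B , C , a≡A , b≡B , c≡C , toWitness ok A B C
         (⟦⟧-cong φ (λ { 0F → a≡A ; 1F → b≡B ; 2F → c≡C }) φabc)

finite-ε? : ∀ m (A B C : Fin (2 ^ suc m)) → Dec (Obstructed _ A B C × Covered (2 ^ m) A B C)
finite-ε? m A B C = obstructed? _ A B C ×-dec covered? (2 ^ m) A B C

-- The `True` arguments are filled by evaluation, so each use of the lemma runs the enumeration for
-- its own formula.
ε₂-finite : ∀ m {2^1+m∣16 : True (2 ^ suc m ℕ.∣? 16)} (φ : Formula (2 ^ suc m))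
  {ok : True (onResidues? φ (finite-ε? m))} → ∀ a b c →
  ⟦ φ ⟧ (a ∷ b ∷ c ∷ []) → IsEpsilon (diagonal a b c) 2 [ suc m ]
ε₂-finite m {2^1+m∣16} φ {ok} a b c φabc =
  let A , B , C , a≡A , b≡B , c≡C , obs , cov =
        onResidues φ (finite-ε? m) ⦃ ℕ.m^n≢0 2 (suc m) ⦄ ok a b c φabc
  in isEpsilon-suc (diagonal a b c) 2 m
       (obstructed⇒obstruction a b c A B C (toWitness 2^1+m∣16) a≡A b≡B c≡C obs)
       (covered⇒universal ⦃ ℕ.m^n≢0 2 m ⦄ a b c A B C (^-mono-∣ 2 (ℕ.n≤1+n m)) a≡A b≡B c≡C cov)

universal-mod-16 : (φ : Formula 16) {ok : True (onResidues? φ (covered? 16))} → ∀ a b c →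
  ⟦ φ ⟧ (a ∷ b ∷ c ∷ []) → Universal (diagonal a b c) 16
universal-mod-16 φ {ok} a b c φabc =
  let A , B , C , a≡A , b≡B , c≡C , cov = onResidues φ (covered? 16) ok a b c φabc
  in covered⇒universal a b c A B C ℕ.∣-refl a≡A b≡B c≡C cov

-- Arithmetic modulo a prime

euclid : ∀ {p} → Prime p → ∀ m n → + p ∣ m * n → + p ∣ m ⊎ + p ∣ n
euclid p-prime m n p∣mn = Sum.map ∣ᵤ⇒∣ ∣ᵤ⇒∣
  (euclidsLemma ℤ.∣ m ∣ ℤ.∣ n ∣ p-prime (subst (_ ℕ.∣_) (abs-* m n) (∣⇒∣ᵤ p∣mn)))

euclid-∤ : ∀ {p} → Prime p → ∀ m n → ¬ (+ p ∣ m) → ¬ (+ p ∣ n) → ¬ (+ p ∣ m * n)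
euclid-∤ p-prime m n p∤m p∤n = [ p∤m , p∤n ]′ ∘ euclid p-prime m n

∤-prime-2 : ∀ {p} → Prime p → p ≢ 2 → ¬ (+ p ∣ + 2)
∤-prime-2 p-prime p≢2 p∣2 with prime⇒irreducible prime[2] (∣⇒∣ᵤ p∣2)
... | inj₂ p≡2  = p≢2 p≡2
... | inj₁ refl with () ← p-prime

coprime⇒inverse : ∀ {k r} → Coprime k r → ∃ λ w → + r * w ≡ 1ℤ [mod k ]
coprime⇒inverse {k} {r} k⊥r = inverse (coprime-Bézout k⊥r)
  where
  cast : ∀ m n o q → 1 ℕ.+ m ℕ.* n ≡ o ℕ.* q → 1ℤ + + m * + n ≡ + o * + q
  cast m n o q eq = trans (cong (_+_ 1ℤ) (sym (pos-* m n))) (trans (cong +_ eq) (pos-* o q))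

  negated : ∀ r y → - (1ℤ + y * r) ≡ r * - y - 1ℤ
  negated = solve-∀

  moved : ∀ r y d → y * r ≡ 1ℤ + d → r * y - 1ℤ ≡ d
  moved r y d eq = trans (cong (_- 1ℤ) (trans (*-comm r y) eq)) (cancel d)
    where
    cancel : ∀ d → 1ℤ + d - 1ℤ ≡ d
    cancel = solve-∀

  inverse : Bézout.Identity 1 k r → ∃ λ w → + r * w ≡ 1ℤ [mod k ]
  -- Here 1 + y r = x k, so the inverse of r is -y; in the other case 1 + x k = y r, and it is y.
  inverse (Bézout.+- x y eq) = - + y , subst (+ k ∣_) (negated (+ r) (+ y))
    (∣m⇒∣-m {+ k} {1ℤ + + y * + r} (divides (+ x) (cast y r x k eq)))
  inverse (Bézout.-+ x y eq) = + y ,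
    divides (+ x) (moved (+ r) (+ y) (+ x * + k) (sym (cast x k y r eq)))

inverse-mod : ∀ {p} → Prime p → ∀ v → ¬ (+ p ∣ v) → ∃ λ w → v * w ≡ 1ℤ [mod p ]
inverse-mod {p} p-prime v p∤v = via-residue (mod-residue v p ⦃ prime⇒nonZero p-prime ⦄)
  where
  via-residue : (∃ λ (r : Fin p) → v ≡ + toℕ r [mod p ]) → ∃ λ w → v * w ≡ 1ℤ [mod p ]
  via-residue (r , v≡r) with toℕ r ℕ.≟ 0
  ... | yes r≡0 = contradiction
    (mod-resp-∣ (+ toℕ r) v ℕ.∣-refl (mod-sym v (+ toℕ r) v≡r)
      (subst (λ s → + p ∣ + s) (sym r≡0) (divides 0ℤ refl))) p∤v
  ... | no r≢0 =
    let w , rw≡1 = coprime⇒inverse (prime⇒coprime p-prime ⦃ ℕ.≢-nonZero r≢0 ⦄ (toℕ<n r))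
    in w , mod-trans (v * w) (+ toℕ r * w) 1ℤ
             (mod-* v (+ toℕ r) w w v≡r (mod-refl w)) rw≡1

-- Hensel lifting

-- Half the derivative of u x² - m is u x. Its being prime to p makes the root liftable, and the
-- condition is carried along so that lifting can be repeated.
UnitSolution : ℕ → ℤ → ℤ → ℕ → Set
UnitSolution p u m k = ∃ λ x → ¬ (+ p ∣ u * x) × (u * (x * x) ≡ m [mod k ])

-- The target m is quantified inside so that it can later absorb the other two terms of the form.
Lifts : ℕ → ℕ → ℤ → ℤ → Set
Lifts p k u x = ∀ m → u * (x * x) ≡ m [mod k ] → ∀ n → ∃ λ x′ → u * (x′ * x′) ≡ m [mod p ^ n ]

iterate : ∀ {p k₀} u m →
  (∀ n → UnitSolution p u m (p ^ n ℕ.* k₀) → UnitSolution p u m (p ℕ.* (p ^ n ℕ.* k₀))) →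
  UnitSolution p u m k₀ → ∀ n → UnitSolution p u m (p ^ n ℕ.* k₀)
iterate {p} {k₀} u m step base zero    = subst (UnitSolution p u m) (sym (ℕ.*-identityˡ k₀)) base
iterate {p} {k₀} u m step base (suc n) =
  subst (UnitSolution p u m) (sym (ℕ.*-assoc p (p ^ n) k₀)) (step n (iterate u m step base n))

-- After n steps the modulus is p^n k₀. Keeping the surplus factor k₀ to the end ensures that k₀
-- divides the modulus at every step, where k₀ is p for odd p and 8 for p = 2.
hensel : ∀ {p k₀} u x →
  (∀ m k → k₀ ℕ.∣ k → UnitSolution p u m k → UnitSolution p u m (p ℕ.* k)) →
  ¬ (+ p ∣ u * x) → Lifts p k₀ u x
hensel {p} {k₀} u x step p∤ux m eq n
  with x′ , _ , eq′ ← iterate u m (λ i → step m _ (ℕ.n∣m*n (p ^ i))) (x , p∤ux , eq) n =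
  x′ , mod-weaken (u * (x′ * x′)) m (ℕ.m∣m*n k₀) eq′

unit-shift : ∀ {p} u x d → ¬ (+ p ∣ u * x) → + p ∣ d → ¬ (+ p ∣ u * (x + d))
unit-shift u x d p∤ux p∣d p∣ux′ = p∤ux (subst (_ ∣_) (cancel u x d) (∣m∣n⇒∣m-n p∣ux′ (∣n⇒∣m*n u p∣d)))
  where
  cancel : ∀ u x d → u * (x + d) - u * d ≡ u * x
  cancel = solve-∀

-- Newton's step: if u x² - m = q k, then x + k t gives (q + 2 u x t) k + u t² k². Since p divides
-- k, the last term is divisible by p k; since 2 u x is invertible modulo p, t can be chosen to make
-- p divide the bracket.
odd-step : ∀ {p} → Prime p → p ≢ 2 → ∀ u m k → p ℕ.∣ k →
           UnitSolution p u m k → UnitSolution p u m (p ℕ.* k)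
odd-step {p} p-prime p≢2 u m k p∣k (x , p∤ux , divides q eq)
  with w , vw≡1 ← inverse-mod p-prime (+ 2 * (u * x))
                    (euclid-∤ p-prime (+ 2) (u * x) (∤-prime-2 p-prime p≢2) p∤ux) =
  x + + k * t , unit-shift u x (+ k * t) p∤ux (∣m⇒∣m*n t (pos-∣ p∣k)) ,
  subst (_∣ u * ((x + + k * t) * (x + + k * t)) - m) (sym (pos-* p k))
    (subst (+ p * + k ∣_) (sym expansion)
      (∣m∣n⇒∣m+n (*-monoˡ-∣ (+ k) p∣q+vt)
        (∣n⇒∣m*n (u * (t * t)) (*-monoˡ-∣ (+ k) (pos-∣ p∣k)))))
  where
  t = - (w * q)
  v = + 2 * (u * x)
  p∣q+vt : + p ∣ q + v * t
  p∣q+vt = subst (+ p ∣_) (factor q v w) (∣n⇒∣m*n (- q) vw≡1)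
    where
    factor : ∀ q v w → - q * (v * w - 1ℤ) ≡ q + v * - (w * q)
    factor = solve-∀

  expand : ∀ u x k t m → u * ((x + k * t) * (x + k * t)) - m ≡
           (u * (x * x) - m) + (+ 2 * (u * x) * t * k + u * (t * t) * (k * k))
  expand = solve-∀

  collect : ∀ q v t k s → q * k + (v * t * k + s) ≡ (q + v * t) * k + s
  collect = solve-∀

  expansion : u * ((x + + k * t) * (x + + k * t)) - m ≡
              (q + v * t) * + k + u * (t * t) * (+ k * + k)
  expansion = trans (expand u x (+ k) t m)
    (trans (cong (_+ (v * t * + k + u * (t * t) * (+ k * + k))) eq)
           (collect q v t (+ k) (u * (t * t) * (+ k * + k))))

1+odd-even : ∀ v → ¬ (+ 2 ∣ v) → + 2 ∣ 1ℤ + v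
1+odd-even v 2∤v with mod-residue v 2
... | 0F , v≡0 = contradiction (mod-resp-∣ 0ℤ v ℕ.∣-refl (mod-sym v 0ℤ v≡0) (divides 0ℤ refl)) 2∤v
... | 1F , v≡1 = subst (+ 2 ∣_) (shift v) (∣m∣n⇒∣m+n v≡1 (∣-refl {+ 2}))
  where
  shift : ∀ v → v - 1ℤ + + 2 ≡ 1ℤ + v
  shift = solve-∀

-- The derivative 2ux is divisible by 2, so the solution moves by a multiple of k / 2 only.
two-step : ∀ u m k → 8 ℕ.∣ k → UnitSolution 2 u m k → UnitSolution 2 u m (2 ℕ.* k)
two-step u m k 8∣k (x , 2∤ux , divides q eq) with divides j k≡j*8 ← pos-∣ 8∣k =
  -- With k = 8j the shift is q k / 2, and the quotient q becomes q (1 + u x) + 2 u j q², which is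
  -- even because u x is odd.
  x + j * + 4 * q ,
  unit-shift u x (j * + 4 * q) 2∤ux (∣m⇒∣m*n q (∣n⇒∣m*n j (divides (+ 2) refl))) ,
  subst (_∣ u * ((x + j * + 4 * q) * (x + j * + 4 * q)) - m) (sym (pos-* 2 k))
    (subst (+ 2 * + k ∣_) (sym expansion) (*-monoˡ-∣ (+ k)
      (∣m∣n⇒∣m+n (∣n⇒∣m*n q (1+odd-even (u * x) 2∤ux)) (∣m⇒∣m*n (u * j * (q * q)) (∣-refl {+ 2})))))
  where
  expand : ∀ u x j q m → u * ((x + j * + 4 * q) * (x + j * + 4 * q)) - m ≡
           (u * (x * x) - m) + (q * (u * x) + + 2 * (u * j * (q * q))) * (j * + 8)
  expand = solve-∀

  collect : ∀ q k v s → q * k + (q * v + s) * k ≡ (q * (1ℤ + v) + s) * k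
  collect = solve-∀

  expansion : u * ((x + j * + 4 * q) * (x + j * + 4 * q)) - m ≡
              (q * (1ℤ + u * x) + + 2 * (u * j * (q * q))) * + k
  expansion = trans (expand u x j q m)
    (trans (cong₂ (λ A K → A + (q * (u * x) + + 2 * (u * j * (q * q))) * K) eq (sym k≡j*8))
           (collect q (+ k) (u * x) (+ 2 * (u * j * (q * q)))))

lifts-odd : ∀ {p} → Prime p → p ≢ 2 → ∀ u x → ¬ (+ p ∣ u * x) → Lifts p p u x
lifts-odd p-prime p≢2 u x = hensel u x (odd-step p-prime p≢2 u)

-- For u = 2u′ the congruence modulo 16 is twice one modulo 8 with the odd coefficient u′.
lifts-2 : ∀ u x → ¬ (+ 4 ∣ u) → ¬ (+ 2 ∣ x) → Lifts 2 16 u x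
lifts-2 u x 4∤u 2∤x m eq n with + 2 ∣? u
... | no 2∤u = hensel u x (two-step u) (euclid-∤ prime[2] u x 2∤u 2∤x) m
                 (mod-weaken (u * (x * x)) m (ℕ.divides 2 refl) eq) n
... | yes (divides u′ refl) with divides q eq′ ← eq =
  let x′ , eq″ = hensel u′ x (two-step u′) (euclid-∤ prime[2] u′ x 2∤u′ 2∤x) m′
                   (divides q (cancel (u′ * (x * x)) (q * + 8))) n
  in x′ , subst (+ (2 ^ n) ∣_)
       (trans (double u′ x′ (u′ * (x * x)) (q * + 8))
              (cong (λ d → u′ * + 2 * (x′ * x′) - d) m′-half)) (∣n⇒∣m*n (+ 2) eq″)
  where
  -- Since 2 u′ x² - m = 16 q, this is m / 2 written without division.
  m′ = u′ * (x * x) - q * + 8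
  2∤u′ : ¬ (+ 2 ∣ u′)
  2∤u′ (divides s refl) = 4∤u (divides s (assoc s))
    where
    assoc : ∀ s → s * + 2 * + 2 ≡ s * + 4
    assoc = solve-∀

  cancel : ∀ s d → s - (s - d) ≡ d
  cancel = solve-∀

  double : ∀ u x s d → + 2 * (u * (x * x) - (s - d)) ≡ u * + 2 * (x * x) - + 2 * (s - d)
  double = solve-∀

  regroup : ∀ u s m q → + 2 * (u * s - q * + 8) ≡ u * + 2 * s - q * + 16
  regroup = solve-∀

  m′-half : + 2 * (u′ * (x * x) - q * + 8) ≡ m
  m′-half = trans (regroup u′ (x * x) m q)
    (trans (cong (λ d → u′ * + 2 * (x * x) - d) (sym eq′)) (cancel (u′ * + 2 * (x * x)) m))

-- Two variables are frozen and their terms moved into the target, which leaves a congruence in the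
-- one variable that lifts.
represents-by-lifting : ∀ {p k} a b c l x y z → diagonal a b c x y z ≡ l [mod k ] →
  Lifts p k a x ⊎ Lifts p k b y ⊎ Lifts p k c z → ∀ n → Represents (diagonal a b c) l (p ^ n)
represents-by-lifting a b c l x y z Q≡l (inj₁ lift) n =
  let X , eq = lift (l - b * (y * y) - c * (z * z))
                 (subst (_ ∣_) (isolate (a * (x * x)) (b * (y * y)) (c * (z * z)) l) Q≡l) n
  in X , y , z , subst (_ ∣_) (sym (isolate (a * (X * X)) (b * (y * y)) (c * (z * z)) l)) eq
  where
  isolate : ∀ A B C l → A + B + C - l ≡ A - (l - B - C)
  isolate = solve-∀
represents-by-lifting a b c l x y z Q≡l (inj₂ (inj₁ lift)) n =
  let Y , eq = lift (l - a * (x * x) - c * (z * z))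
                 (subst (_ ∣_) (isolate (a * (x * x)) (b * (y * y)) (c * (z * z)) l) Q≡l) n
  in x , Y , z , subst (_ ∣_) (sym (isolate (a * (x * x)) (b * (Y * Y)) (c * (z * z)) l)) eq
  where
  isolate : ∀ A B C l → A + B + C - l ≡ B - (l - A - C)
  isolate = solve-∀
represents-by-lifting a b c l x y z Q≡l (inj₂ (inj₂ lift)) n =
  let Z , eq = lift (l - a * (x * x) - b * (y * y))
                 (subst (_ ∣_) (isolate (a * (x * x)) (b * (y * y)) (c * (z * z)) l) Q≡l) n
  in x , y , Z , subst (_ ∣_) (sym (isolate (a * (x * x)) (b * (y * y)) (c * (Z * Z)) l)) eq
  where
  isolate : ∀ A B C l → A + B + C - l ≡ C - (l - A - B)
  isolate = solve-∀

square-even : ∀ x → + 2 ∣ x → + 4 ∣ x * x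
square-even x (divides q refl) = divides (q * q) (square q)
  where
  square : ∀ q → q * + 2 * (q * + 2) ≡ q * q * + 4
  square = solve-∀

diagonal-even : ∀ a b c x y z → + 2 ∣ x → + 2 ∣ y → + 2 ∣ z → + 4 ∣ diagonal a b c x y z
diagonal-even a b c x y z 2∣x 2∣y 2∣z = ∣m∣n⇒∣m+n
  (∣m∣n⇒∣m+n (∣n⇒∣m*n a (square-even x 2∣x)) (∣n⇒∣m*n b (square-even y 2∣y)))
  (∣n⇒∣m*n c (square-even z 2∣z))

universal-mod-1 : ∀ Q → Universal Q 1
universal-mod-1 Q l = 0ℤ , 0ℤ , 0ℤ , ∣ᵤ⇒∣ (ℕ.1∣ _)

-- If 4 ∤ l, some variable is odd and lifts; otherwise l = 4m, and a solution for m is doubled.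
universal-2^ : ∀ a b c → ¬ (+ 4 ∣ a) → ¬ (+ 4 ∣ b) → ¬ (+ 4 ∣ c) →
               Universal (diagonal a b c) 16 → ∀ n → Universal (diagonal a b c) (2 ^ n)
universal-2^ a b c 4∤a 4∤b 4∤c univ zero = universal-mod-1 (diagonal a b c)
universal-2^ a b c 4∤a 4∤b 4∤c univ (suc n) l with + 4 ∣? l
... | yes (divides m refl) with x , y , z , eq ← universal-2^ a b c 4∤a 4∤b 4∤c univ n m =
  + 2 * x , + 2 * y , + 2 * z ,
  -- The doubled solution holds modulo 4 · 2^n = 2^(n+2), one power more than required.
  ∣-trans (divides (+ 2) power) (subst (+ (2 ^ n) * + 4 ∣_) (scale a b c x y z m) (*-monoˡ-∣ (+ 4) eq))
  where
  scale : ∀ a b c x y z m → (a * (x * x) + b * (y * y) + c * (z * z) - m) * + 4 ≡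
          a * (+ 2 * x * (+ 2 * x)) + b * (+ 2 * y * (+ 2 * y)) + c * (+ 2 * z * (+ 2 * z)) - m * + 4
  scale = solve-∀

  quadruple : ∀ k → k * + 4 ≡ + 2 * (+ 2 * k)
  quadruple = solve-∀

  power : + (2 ^ n) * + 4 ≡ + 2 * + (2 ^ suc n)
  power = trans (quadruple (+ (2 ^ n))) (cong (_*_ (+ 2)) (sym (pos-* 2 (2 ^ n))))
... | no 4∤l with x , y , z , eq ← univ l = lifted x y z eq
  where
  lifted : ∀ x y z → diagonal a b c x y z ≡ l [mod 16 ] → Represents (diagonal a b c) l (2 ^ suc n)
  lifted x y z eq with + 2 ∣? x | + 2 ∣? y | + 2 ∣? z
  ... | no 2∤x  | _       | _       =
    represents-by-lifting a b c l x y z eq (inj₁ (lifts-2 a x 4∤a 2∤x)) (suc n)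
  ... | yes _   | no 2∤y  | _       =
    represents-by-lifting a b c l x y z eq (inj₂ (inj₁ (lifts-2 b y 4∤b 2∤y))) (suc n)
  ... | yes _   | yes _   | no 2∤z  =
    represents-by-lifting a b c l x y z eq (inj₂ (inj₂ (lifts-2 c z 4∤c 2∤z))) (suc n)
  ... | yes 2∣x | yes 2∣y | yes 2∣z = contradiction
    (mod-resp-∣ (diagonal a b c x y z) l (ℕ.divides 4 refl) eq (diagonal-even a b c x y z 2∣x 2∣y 2∣z)) 4∤l

-- Odd primes

<-incongruent : ∀ {i j k} → i ℕ.< j → j ℕ.< k → ¬ (+ j ≡ + i [mod k ])
<-incongruent {i} {j} {k} i<j j<k j≡i =
  ℕ.>⇒∤ ⦃ ℕ.>-nonZero (ℕ.m<n⇒0<n∸m i<j) ⦄ (ℕ.≤-<-trans (ℕ.m∸n≤m j i) j<k)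
    (∣⇒∣ᵤ (subst (+ k ∣_) (trans (m-n≡m⊖n j i) (⊖-≥ (ℕ.<⇒≤ i<j))) j≡i))

-- In j² - i² = (j - i)(j + i) both factors lie strictly between 0 and p, because i < j ≤ h and p =
-- 2h + 1.
square-injective : ∀ {p h} → Prime p → p ≡ 1 ℕ.+ h ℕ.* 2 → ∀ u → ¬ (+ p ∣ u) →
  ∀ (i j : Fin (suc h)) → toℕ i ℕ.< toℕ j →
  ¬ (u * (+ toℕ j * + toℕ j) ≡ u * (+ toℕ i * + toℕ i) [mod p ])
square-injective {p} {h} p-prime p≡1+2h u p∤u i j i<j eq =
  [ p∤u , [ <-incongruent i<j j<p , p∤sum ]′ ∘ euclid p-prime (+ toℕ j - + toℕ i) (+ (toℕ j ℕ.+ toℕ i)) ]′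
    (euclid p-prime u ((+ toℕ j - + toℕ i) * (+ toℕ j + + toℕ i))
      (subst (+ p ∣_) (factor u (+ toℕ j) (+ toℕ i)) eq))
  where
  factor : ∀ u x y → u * (x * x) - u * (y * y) ≡ u * ((x - y) * (x + y))
  factor = solve-∀

  sum<p : toℕ j ℕ.+ toℕ i ℕ.< p
  sum<p = subst (toℕ j ℕ.+ toℕ i ℕ.<_) (sym p≡1+2h)
    (ℕ.s≤s (subst (toℕ j ℕ.+ toℕ i ℕ.≤_) h+h≡h*2
      (ℕ.+-mono-≤ (ℕ.s≤s⁻¹ (toℕ<n j)) (ℕ.s≤s⁻¹ (toℕ<n i)))))
    where
    h+h≡h*2 : h ℕ.+ h ≡ h ℕ.* 2
    h+h≡h*2 = trans (cong (h ℕ.+_) (sym (ℕ.+-identityʳ h))) (ℕ.*-comm 2 h)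

  j<p : toℕ j ℕ.< p
  j<p = ℕ.≤-<-trans (ℕ.m≤m+n (toℕ j) (toℕ i)) sum<p

  p∤sum : ¬ (+ p ∣ + (toℕ j ℕ.+ toℕ i))
  p∤sum p∣sum = ℕ.>⇒∤ ⦃ ℕ.>-nonZero (ℕ.<-≤-trans (ℕ.m<n⇒0<n i<j) (ℕ.m≤m+n (toℕ j) (toℕ i))) ⦄
    sum<p (∣⇒∣ᵤ p∣sum)

odd-prime-half : ∀ {p} → Prime p → p ≢ 2 → ∃ λ h → p ≡ 1 ℕ.+ h ℕ.* 2
odd-prime-half {p} p-prime p≢2 with p ℕ.% 2 in p%2 | ℕ.m≡m%n+[m/n]*n p 2 | ℕ.m%n<n p 2
... | 1 | p≡ | _ = p ℕ./ 2 , p≡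
... | suc (suc _) | _ | ℕ.s≤s (ℕ.s≤s ())
... | 0 | _ | _ with prime⇒irreducible p-prime (ℕ.m%n≡0⇒n∣m p 2 p%2)
... | inj₂ 2≡p = contradiction (sym 2≡p) p≢2

-- The 1 + h values b y² with 0 ≤ y ≤ h are distinct modulo p = 2h + 1, and so are the values l − c z².
binary-universal : ∀ {p} → Prime p → p ≢ 2 → ∀ b c → ¬ (+ p ∣ b) → ¬ (+ p ∣ c) →
  ∀ l → ∃ λ y → ∃ λ z → b * (y * y) + c * (z * z) ≡ l [mod p ]
binary-universal {p} p-prime p≢2 b c p∤b p∤c l with h , p≡1+2h ← odd-prime-half p-prime p≢2 =
  -- There are 2 (h + 1) = p + 1 indices for p residue classes; `splitAt` tells to which of the two
  -- families an index belongs.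
  let i , j , i<j , ρi≡ρj = pigeonhole (more h p≡1+2h) (ρ ∘ value h ∘ splitAt (suc h))
  in collide h p≡1+2h (splitAt (suc h) i) (splitAt (suc h) j)
       (λ eq → <⇒≢ i<j (trans (sym (join-splitAt (suc h) (suc h) i))
                         (trans (cong (join (suc h) (suc h)) eq) (join-splitAt (suc h) (suc h) j))))
       (same-residue (value h (splitAt (suc h) i)) (value h (splitAt (suc h) j)) ρi≡ρj)
  where
  reduced : ∀ x → ∃ λ (r : Fin p) → x ≡ + toℕ r [mod p ]
  reduced x = mod-residue x p ⦃ prime⇒nonZero p-prime ⦄

  ρ : ℤ → Fin p
  ρ x = proj₁ (reduced x)

  same-residue : ∀ x y → ρ x ≡ ρ y → x ≡ y [mod p ]
  same-residue x y ρx≡ρy = mod-trans x (+ toℕ (ρ x)) y (proj₂ (reduced x))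
    (mod-sym y (+ toℕ (ρ x)) (subst (λ r → y ≡ + toℕ r [mod p ]) (sym ρx≡ρy) (proj₂ (reduced y))))

  more : ∀ h → p ≡ 1 ℕ.+ h ℕ.* 2 → p ℕ.< suc h ℕ.+ suc h
  more h p≡ = ℕ.≤-reflexive (trans (cong suc p≡) (sym
    (trans (cong suc (ℕ.+-suc h h)) (cong (2 ℕ.+_) (trans (cong (h ℕ.+_) (sym (ℕ.+-identityʳ h))) (ℕ.*-comm 2 h))))))

  value : ∀ h → Fin (suc h) ⊎ Fin (suc h) → ℤ
  value h (inj₁ y) = b * (+ toℕ y * + toℕ y)
  value h (inj₂ z) = l - c * (+ toℕ z * + toℕ z)

  meet : ∀ B C l → B - (l - C) ≡ B + C - l
  meet = solve-∀

  flip : ∀ C D l → (l - C) - (l - D) ≡ D - C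
  flip = solve-∀

  -- A collision inside one family contradicts `square-injective`, so the two values come from
  -- different families and give b y² ≡ l - c z².
  collide : ∀ h → p ≡ 1 ℕ.+ h ℕ.* 2 → ∀ s t → s ≢ t → value h s ≡ value h t [mod p ] →
            ∃ λ y → ∃ λ z → b * (y * y) + c * (z * z) ≡ l [mod p ]
  collide h p≡ (inj₁ y) (inj₂ z) _ eq = + toℕ y , + toℕ z ,
    subst (+ p ∣_) (meet (b * (+ toℕ y * + toℕ y)) (c * (+ toℕ z * + toℕ z)) l) eq
  collide h p≡ (inj₂ z) (inj₁ y) s≢t eq =
    collide h p≡ (inj₁ y) (inj₂ z) (s≢t ∘ sym) (mod-sym (value h (inj₂ z)) (value h (inj₁ y)) eq)
  collide h p≡ (inj₁ i) (inj₁ j) s≢t eq with ℕ.<-cmp (toℕ i) (toℕ j)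
  ... | tri< i<j _ _ = contradiction (mod-sym (value h (inj₁ i)) (value h (inj₁ j)) eq)
                                     (square-injective p-prime p≡ b p∤b i j i<j)
  ... | tri≈ _ i≡j _ = contradiction (cong inj₁ (toℕ-injective i≡j)) s≢t
  ... | tri> _ _ j<i = contradiction eq (square-injective p-prime p≡ b p∤b j i j<i)
  collide h p≡ (inj₂ i) (inj₂ j) s≢t eq with ℕ.<-cmp (toℕ i) (toℕ j)
  ... | tri< i<j _ _ = contradiction
    (subst (+ p ∣_) (flip (c * (+ toℕ i * + toℕ i)) (c * (+ toℕ j * + toℕ j)) l) eq)
    (square-injective p-prime p≡ c p∤c i j i<j)
  ... | tri≈ _ i≡j _ = contradiction (cong inj₂ (toℕ-injective i≡j)) s≢t
  ... | tri> _ _ j<i = contradiction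
    (mod-sym (c * (+ toℕ j * + toℕ j)) (c * (+ toℕ i * + toℕ i))
      (subst (+ p ∣_) (flip (c * (+ toℕ i * + toℕ i)) (c * (+ toℕ j * + toℕ j)) l) eq))
    (square-injective p-prime p≡ c p∤c j i j<i)

-- Since 1² ≡ (k − 1)², the values d w² are already taken on k − 1 residues w, so they miss one of k classes.
unattained : ∀ k → 3 ℕ.≤ k → ∀ d → ∃ λ t → ∀ w → ¬ (d * (w * w) ≡ t [mod k ])
unattained (suc q) (ℕ.s≤s 2≤q) d =
  let t , missed = ¬∀⟶∃¬ (suc q) Attained attained? ¬all-attained
  in + toℕ t , λ w eq → missed (represent w eq)
  where
  Attained : Fin (suc q) → Set
  Attained t = ∃ λ (w : Fin q) → d * (+ toℕ w * + toℕ w) ≡ + toℕ t [mod suc q ]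

  attained? : ∀ t → Dec (Attained t)
  attained? t = any? λ w → d * (+ toℕ w * + toℕ w) ≡ + toℕ t [mod suc q ]?

  ¬all-attained : ¬ (∀ t → Attained t)
  ¬all-attained attained =
    -- If all q + 1 classes were attained from q values of w, two distinct classes would share a w
    -- and hence coincide.
    let i , j , i<j , wi≡wj = pigeonhole (ℕ.n<1+n q) (proj₁ ∘ attained)
        v = λ t → d * (+ toℕ (proj₁ (attained t)) * + toℕ (proj₁ (attained t)))
    in <-incongruent i<j (toℕ<n j)
         (mod-trans (+ toℕ j) (v i) (+ toℕ i)
           (mod-sym (v i) (+ toℕ j)
             (subst (λ w → d * (+ toℕ w * + toℕ w) ≡ + toℕ j [mod suc q ]) (sym wi≡wj)
               (proj₂ (attained j))))
           (proj₂ (attained i)))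

  last-square : ∀ q → q * q - 1ℤ ≡ (q - 1ℤ) * (1ℤ + q)
  last-square = solve-∀

  move : ∀ w r t → w * w ≡ r * r [mod suc q ] → d * (w * w) ≡ t [mod suc q ] → d * (r * r) ≡ t [mod suc q ]
  move w r t w²≡r² = mod-trans (d * (r * r)) (d * (w * w)) t
    (mod-* d d (r * r) (w * w) (mod-refl d) (mod-sym (w * w) (r * r) w²≡r²))

  at : ∀ {n} t (n<q : n ℕ.< q) → d * (+ n * + n) ≡ t [mod suc q ] →
       ∃ λ (w : Fin q) → d * (+ toℕ w * + toℕ w) ≡ t [mod suc q ]
  at t n<q = λ eq → fromℕ< n<q , subst (λ n → d * (+ n * + n) ≡ t [mod suc q ]) (sym (toℕ-fromℕ< n<q)) eq

  represent : ∀ {t} w → d * (w * w) ≡ t [mod suc q ] →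
              ∃ λ (w : Fin q) → d * (+ toℕ w * + toℕ w) ≡ t [mod suc q ]
  represent {t} w eq with r , w≡r ← mod-residue w (suc q) with ℕ.m≤n⇒m<n∨m≡n (ℕ.s≤s⁻¹ (toℕ<n r))
  ... | inj₁ r<q = at t r<q (move w (+ toℕ r) t (mod-* w (+ toℕ r) w (+ toℕ r) w≡r w≡r) eq)
  -- The residue q is -1 modulo q + 1, so 1 takes its place; 2 ≤ q puts 1 within `Fin q`.
  ... | inj₂ r≡q = at t 2≤q (move w 1ℤ t
    (mod-trans (w * w) (+ q * + q) 1ℤ
      (subst (λ r → w * w ≡ + r * + r [mod suc q ]) r≡q (mod-* w (+ toℕ r) w (+ toℕ r) w≡r w≡r))
      (divides (+ q - 1ℤ) (last-square (+ q)))) eq)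

odd-prime≥3 : ∀ {p} → Prime p → p ≢ 2 → 3 ℕ.≤ p
odd-prime≥3 {p} p-prime p≢2 =
  ℕ.≤∧≢⇒< (ℕ.nonTrivial⇒n>1 p ⦃ prime⇒nonTrivial p-prime ⦄) (p≢2 ∘ sym)

-- The class missed by w ↦ d w² is missed by the whole form. This serves forms with two coefficients
-- divisible by p, which reduce to one term modulo p.
obstructed-by-one-square : ∀ {p} → Prime p → p ≢ 2 → ∀ Q d →
  (∀ x y z → ∃ λ w → Q x y z ≡ d * (w * w) [mod p ]) → LocalObstruction Q (p ^ 1)
obstructed-by-one-square {p} p-prime p≢2 Q d square
  with t , missed ← unattained p (odd-prime≥3 p-prime p≢2) d = t , never
  where
  never : NeverCongruent Q t (p ^ 1)
  never x y z Q≡t with w , Q≡dw² ← square x y z = missed w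
    (mod-trans (d * (w * w)) (Q x y z) t (mod-sym (Q x y z) (d * (w * w)) Q≡dw²)
      -- `p ^ 1` unfolds to p times 1, hence the passage to p itself.
      (mod-weaken (Q x y z) t (ℕ.m∣m*n 1) Q≡t))

-- For odd p the labelling fixes no positions in this case, so each pair is treated; modulo p only
-- the third term remains. Universality is asked only modulo p^0 = 1.
two-divisible : ∀ {p} → Prime p → p ≢ 2 → ∀ a b c →
  (+ p ∣ a × + p ∣ b) ⊎ (+ p ∣ a × + p ∣ c) ⊎ (+ p ∣ b × + p ∣ c) →
  IsEpsilon (diagonal a b c) p [ 1 ]
two-divisible {p} p-prime p≢2 a b c two =
  isEpsilon-suc (diagonal a b c) p 0 (obstruction two) (universal-mod-1 (diagonal a b c))
  where
  drop-ab : ∀ A B C → A + B ≡ A + B + C - C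
  drop-ab = solve-∀
  drop-ac : ∀ A B C → A + C ≡ A + B + C - B
  drop-ac = solve-∀
  drop-bc : ∀ A B C → B + C ≡ A + B + C - A
  drop-bc = solve-∀

  obstruction : (+ p ∣ a × + p ∣ b) ⊎ (+ p ∣ a × + p ∣ c) ⊎ (+ p ∣ b × + p ∣ c) →
                LocalObstruction (diagonal a b c) (p ^ 1)
  obstruction (inj₁ (p∣a , p∣b)) = obstructed-by-one-square p-prime p≢2 (diagonal a b c) c
    λ x y z → z , subst (+ p ∣_) (drop-ab (a * (x * x)) (b * (y * y)) (c * (z * z)))
      (∣m∣n⇒∣m+n (∣m⇒∣m*n (x * x) p∣a) (∣m⇒∣m*n (y * y) p∣b))
  obstruction (inj₂ (inj₁ (p∣a , p∣c))) = obstructed-by-one-square p-prime p≢2 (diagonal a b c) b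
    λ x y z → y , subst (+ p ∣_) (drop-ac (a * (x * x)) (b * (y * y)) (c * (z * z)))
      (∣m∣n⇒∣m+n (∣m⇒∣m*n (x * x) p∣a) (∣m⇒∣m*n (z * z) p∣c))
  obstruction (inj₂ (inj₂ (p∣b , p∣c))) = obstructed-by-one-square p-prime p≢2 (diagonal a b c) a
    λ x y z → x , subst (+ p ∣_) (drop-bc (a * (x * x)) (b * (y * y)) (c * (z * z)))
      (∣m∣n⇒∣m+n (∣m⇒∣m*n (y * y) p∣b) (∣m⇒∣m*n (z * z) p∣c))

-- If z were invertible modulo p with inverse w, then byw would be a square root of −bc.
anisotropic : ∀ {p} → Prime p → ∀ b c → ¬ (+ p ∣ b) → ¬ QuadraticResidue (- (b * c)) p →
  ∀ y z → + p ∣ b * (y * y) + c * (z * z) → + p ∣ y × + p ∣ z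
anisotropic {p} p-prime b c p∤b nonresidue y z p∣sum with + p ∣? z
... | no p∤z with w , zw≡1 ← inverse-mod p-prime z p∤z = contradiction
  -- The sum times b w² is (b y w)² + b c (z w)², and z w ≡ 1 turns the last term into b c.
  (b * y * w , subst (+ p ∣_) (square b c y z w)
    (∣m∣n⇒∣m-n (∣n⇒∣m*n (b * (w * w)) p∣sum) (∣n⇒∣m*n (b * c * (z * w + 1ℤ)) zw≡1)))
  nonresidue
  where
  square : ∀ b c y z w → b * (w * w) * (b * (y * y) + c * (z * z)) - b * c * (z * w + 1ℤ) * (z * w - 1ℤ) ≡
           b * y * w * (b * y * w) - - (b * c)
  square = solve-∀
... | yes p∣z = p∣y , p∣z
  where
  p∣by² : + p ∣ b * (y * y)
  p∣by² = ∣m+n∣n⇒∣m {m = b * (y * y)} p∣sum (∣n⇒∣m*n c (∣m⇒∣m*n z p∣z))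

  p∣y : + p ∣ y
  p∣y = [ (λ p∣b → contradiction p∣b p∤b) , [ id , id ]′ ∘ euclid p-prime y y ]′ (euclid p-prime b (y * y) p∣by²)

-- Write a = a′ p and let t be missed by w ↦ a′ w² modulo p; then t p is missed modulo p². Indeed
-- anisotropy forces p to divide y and z, so b y² + c z² vanishes modulo p², and cancelling p would
-- leave a′ x² ≡ t.
obstructed-p² : ∀ {p} → Prime p → p ≢ 2 → ∀ a b c → + p ∣ a → ¬ (+ p ∣ b) →
  ¬ QuadraticResidue (- (b * c)) p → LocalObstruction (diagonal a b c) (p ^ 2)
obstructed-p² {p} p-prime p≢2 a b c (divides a′ refl) p∤b nonresidue
  with t , missed ← unattained p (odd-prime≥3 p-prime p≢2) a′ = t * + p , never
  where
  split : ∀ a t x y z b c p → (a * p * (x * x) + b * (y * y) + c * (z * z) - t * p) - (a * (x * x) - t) * p ≡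
          b * (y * y) + c * (z * z)
  split = solve-∀

  factor : ∀ a t x y z b c p →
    (a * p * (x * x) + b * (y * p * (y * p)) + c * (z * p * (z * p)) - t * p)
      - (b * (y * y) + c * (z * z)) * (p * p) ≡ (a * (x * x) - t) * p
  factor = solve-∀

  p²≡ : + (p ^ 2) ≡ + p * + p
  p²≡ = trans (cong (λ q → + (p ℕ.* q)) (ℕ.*-identityʳ p)) (pos-* p p)

  never : NeverCongruent (diagonal a b c) (t * + p) (p ^ 2)
  never x y z Q≡tp
    with anisotropic p-prime b c p∤b nonresidue y z
           (subst (+ p ∣_) (split a′ t x y z b c (+ p))
             (∣m∣n⇒∣m-n (mod-weaken (diagonal a b c x y z) (t * + p) (ℕ.m∣m*n (p ^ 1)) Q≡tp)
               (∣n⇒∣m*n (a′ * (x * x) - t) (∣-refl {+ p}))))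
  ... | divides y′ refl , divides z′ refl = missed x
    (*-cancelʳ-∣ (+ p) ⦃ prime⇒nonZero p-prime ⦄
      (subst (+ p * + p ∣_) (factor a′ t x y′ z′ b c (+ p))
        (∣m∣n⇒∣m-n (subst (_∣ diagonal a b c x y z - t * + p) p²≡ Q≡tp)
          (∣n⇒∣m*n (b * (y′ * y′) + c * (z′ * z′)) (∣-refl {+ p * + p})))))

-- Universality at odd primes

zero-term : ∀ a B C l → B + C - l ≡ a * (0ℤ * 0ℤ) + B + C - l
zero-term a B C l = cong (λ A → A + C - l) (sym (trans (cong (_+ B) (*-zeroʳ a)) (+-identityˡ B)))

unit-term : ∀ a B C l → B + C - (l - a) ≡ a * (1ℤ * 1ℤ) + B + C - l
unit-term a B C l = trans (move a B C l) (cong (λ A → A + B + C - l) (sym (*-identityʳ a)))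
  where
  move : ∀ a B C l → B + C - (l - a) ≡ a + B + C - l
  move = solve-∀

-- The binary form b y² + c z² already takes every value modulo p, so x = 0 will do.
universal-one-divisible : ∀ {p} → Prime p → p ≢ 2 → ∀ a b c → ¬ (+ p ∣ b) → ¬ (+ p ∣ c) →
                          Universal (diagonal a b c) (p ^ 1)
universal-one-divisible {p} p-prime p≢2 a b c p∤b p∤c l =
  let y , z , eq = binary-universal p-prime p≢2 b c p∤b p∤c l in
  0ℤ , y , z , mod-weaken (diagonal a b c 0ℤ y z) l (ℕ.∣-reflexive (ℕ.*-identityʳ p))
    (subst (+ p ∣_) (zero-term a (b * (y * y)) (c * (z * z)) l) eq)

-- Fixing x = 1 and solving b y² + c z² ≡ l - a makes a x a unit, so the first variable lifts
-- whatever y and z are.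
universal-unramified : ∀ {p} → Prime p → p ≢ 2 → ∀ a b c → ¬ (+ p ∣ a) → ¬ (+ p ∣ b) → ¬ (+ p ∣ c) →
                       ∀ n → Universal (diagonal a b c) (p ^ n)
universal-unramified {p} p-prime p≢2 a b c p∤a p∤b p∤c n l =
  let y , z , eq = binary-universal p-prime p≢2 b c p∤b p∤c (l - a) in
  represents-by-lifting a b c l 1ℤ y z (subst (+ p ∣_) (unit-term a (b * (y * y)) (c * (z * z)) l) eq)
    (inj₁ (lifts-odd p-prime p≢2 a 1ℤ (p∤a ∘ subst (+ p ∣_) (*-identityʳ a)))) n

-- If l is divisible by p, the isotropic vector (s, b) with s² ≡ −bc gives a nonsingular solution.
universal-isotropic : ∀ {p} → Prime p → p ≢ 2 → ∀ a b c → ¬ (+ p ∣ b) → ¬ (+ p ∣ c) →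
  QuadraticResidue (- (b * c)) p → ∀ n → Universal (diagonal a b c) (p ^ n)
universal-isotropic {p} p-prime p≢2 a b c p∤b p∤c (s , s²≡-bc) n l =
  let y , z , eq = binary-universal p-prime p≢2 b c p∤b p∤c l in from-solution y z eq
  where
  vanish : ∀ B C l → B + C - (B + C - l) ≡ l
  vanish = solve-∀

  isotropic : ∀ b c s l → b * (s * s - - (b * c)) - l ≡ b * (s * s) + c * (b * b) - l
  isotropic = solve-∀

  from-solution : ∀ y z → b * (y * y) + c * (z * z) ≡ l [mod p ] → Represents (diagonal a b c) l (p ^ n)
  from-solution y z eq with + p ∣? b * y | + p ∣? c * z
  ... | no p∤by | _ = represents-by-lifting a b c l 0ℤ y z
    (subst (+ p ∣_) (zero-term a (b * (y * y)) (c * (z * z)) l) eq)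
    (inj₂ (inj₁ (lifts-odd p-prime p≢2 b y p∤by))) n
  ... | yes _ | no p∤cz = represents-by-lifting a b c l 0ℤ y z
    (subst (+ p ∣_) (zero-term a (b * (y * y)) (c * (z * z)) l) eq)
    (inj₂ (inj₂ (lifts-odd p-prime p≢2 c z p∤cz))) n
  -- Both terms vanish modulo p, so p divides l, and (0, s, b) is a solution because b s² + c b² = b
  -- (s² + b c). Its last coordinate lifts, as p does not divide c b.
  ... | yes p∣by | yes p∣cz = represents-by-lifting a b c l 0ℤ s b
    (subst (+ p ∣_) (trans (isotropic b c s l) (zero-term a (b * (s * s)) (c * (b * b)) l))
      (∣m∣n⇒∣m-n (∣n⇒∣m*n b s²≡-bc) p∣l))
    (inj₂ (inj₂ (lifts-odd p-prime p≢2 c b (euclid-∤ p-prime c b p∤c p∤b)))) n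
    where
    assoc : ∀ u x → u * x * x ≡ u * (x * x)
    assoc = solve-∀

    p∣l : + p ∣ l
    p∣l = subst (+ p ∣_) (vanish (b * (y * y)) (c * (z * z)) l)
      (∣m∣n⇒∣m-n (∣m∣n⇒∣m+n (subst (+ p ∣_) (assoc b y) (∣m⇒∣m*n y p∣by))
                            (subst (+ p ∣_) (assoc c z) (∣m⇒∣m*n z p∣cz))) eq)

-- Reading off divisor counts and Legendre symbols

exactly-one : ∀ {A B C : Set} (A? : Dec A) (B? : Dec B) (C? : Dec C) →
  (if does A? then suc else id) ((if does B? then suc else id) ((if does C? then suc else id) 0)) ≡ 1 →
  A → ¬ B × ¬ C
exactly-one (yes _) (no ¬b) (no ¬c) _ _ = ¬b , ¬c
exactly-one (yes _) (yes _) (yes _) () _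
exactly-one (yes _) (yes _) (no _)  () _
exactly-one (yes _) (no _)  (yes _) () _
exactly-one (no ¬a) _ _ _ a = contradiction a ¬a

exactly-two : ∀ {A B C : Set} (A? : Dec A) (B? : Dec B) (C? : Dec C) →
  (if does A? then suc else id) ((if does B? then suc else id) ((if does C? then suc else id) 0)) ≡ 2 →
  (A × B) ⊎ (A × C) ⊎ (B × C)
exactly-two (yes a) (yes b) _       _ = inj₁ (a , b)
exactly-two (yes a) (no _)  (yes c) _ = inj₂ (inj₁ (a , c))
exactly-two (no _)  (yes b) (yes c) _ = inj₂ (inj₂ (b , c))
exactly-two (yes _) (no _)  (no _)  ()
exactly-two (no _)  (yes _) (no _)  ()
exactly-two (no _)  (no _)  (yes _) ()
exactly-two (no _)  (no _)  (no _)  ()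

-- As with the counts above, the definition, here `legendre`, appears unfolded and with abstract
-- decisions, so that matching on these makes it compute.
symbol≡-1 : ∀ {A B : Set} (A? : Dec A) (B? : Dec B) →
  (if does A? then 0ℤ else if does B? then 1ℤ else -1ℤ) ≡ -1ℤ → ¬ B
symbol≡-1 (no _) (no ¬b) _ = ¬b
symbol≡-1 (no _) (yes _) ()
symbol≡-1 (yes _) _ ()

symbol≡1 : ∀ {A B : Set} (A? : Dec A) (B? : Dec B) →
  (if does A? then 0ℤ else if does B? then 1ℤ else -1ℤ) ≡ 1ℤ → B
symbol≡1 (no _) (yes b) _ = b
symbol≡1 (no _) (no _) ()
symbol≡1 (yes _) _ ()

-- Conditions on the coefficients at p = 2

∤2⇒∤4 : ∀ a → ¬ (+ 2 ∣ a) → ¬ (+ 4 ∣ a)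
∤2⇒∤4 a 2∤a = 2∤a ∘ ∣-trans (divides (+ 2) refl)

≡2⇒∤4 : ∀ a → a ≡ + 2 [mod 4 ] → ¬ (+ 4 ∣ a)
≡2⇒∤4 a a≡2 4∣a = from-no (+ 4 ∣? + 2) (mod-resp-∣ a (+ 2) ℕ.∣-refl a≡2 4∣a)

-- The modulus stays a parameter because the cases are enumerated modulo 4, 8 or 16.
module _ {k} {2∣k : True (2 ℕ.∣? k)} where

  even : Term → Formula k
  even t = _∣ᶠ_ 2 {2∣k} t

  odd-odd-odd even-even-odd even-odd-odd : Formula k
  odd-odd-odd   = ¬ᶠ even 𝐚 ∧ᶠ ¬ᶠ even 𝐛 ∧ᶠ ¬ᶠ even 𝐜
  even-even-odd = even 𝐚 ∧ᶠ even 𝐛 ∧ᶠ ¬ᶠ even 𝐜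
  even-odd-odd  = even 𝐚 ∧ᶠ ¬ᶠ even 𝐛 ∧ᶠ ¬ᶠ even 𝐜

-- Subtracting 0 mirrors `≡ + 0 [mod 8 ]`, so that the formula unfolds to exactly the stated
-- condition.
sum-condition : Formula 16
sum-condition =
  (4 ∣ᶠ 𝐚 ⊟ con (+ 2) ∧ᶠ 8 ∣ᶠ 𝐚 ⊕ 𝐛 ⊕ 𝐜 ⊟ con (+ 0)) ∨ᶠ
  (4 ∣ᶠ 𝐚 ⊟ con (+ 2) ∧ᶠ 8 ∣ᶠ 𝐛 ⊕ 𝐜 ⊟ con (+ 0))

theorem1p5 :
  ∀ (a b c : ℤ) .⦃ _ : Positive a ⦄ .⦃ _ : Positive b ⦄ .⦃ _ : Positive c ⦄ →
  gcd a (gcd b c) ≡ 1ℤ →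
  let Q = diagonal a b c in
  -- odd primes
  (∀ (p : ℕ) (p-prime : Prime p) → p ≢ 2 → Labelled p a b c →
    (#divisibleBy p (a ∷ b ∷ c ∷ []) ≡ 2 → IsEpsilon Q p [ 1 ])
    × (#divisibleBy p (a ∷ b ∷ c ∷ []) ≡ 1 × legendre (- (b * c)) p p-prime ≡ -1ℤ →
        IsEpsilon Q p [ 2 ])
    × (¬ (+ p ∣ a * b * c)
        ⊎ (#divisibleBy p (a ∷ b ∷ c ∷ []) ≡ 1 × legendre (- (b * c)) p p-prime ≡ 1ℤ) →
        IsEpsilon Q p ∞))
  ×
  -- p = 2
  (Labelled 2 a b c →
    -- (1)
    (¬ (+ 2 ∣ a) × ¬ (+ 2 ∣ b) × ¬ (+ 2 ∣ c) →
      (a ≡ b [mod 4 ] × b ≡ c [mod 4 ] → IsEpsilon Q 2 [ 3 ])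
      × (¬ (a ≡ b [mod 4 ] × b ≡ c [mod 4 ]) → IsEpsilon Q 2 ∞))
    ×
    -- (2)
    (+ 2 ∣ a × + 2 ∣ b × ¬ (+ 2 ∣ c) →
      (+ 4 ∣ a × + 4 ∣ b → IsEpsilon Q 2 [ 2 ])
      × ((a ≡ b [mod 4 ] × b ≡ + 2 [mod 4 ])
          ⊎ (a ≡ + 2 [mod 4 ] × b ≡ + 0 [mod 8 ]) →
          IsEpsilon Q 2 [ 3 ])
      × (a ≡ + 2 [mod 4 ] × b ≡ + 4 [mod 8 ] → IsEpsilon Q 2 [ 4 ]))
    ×
    -- (3)
    (+ 2 ∣ a × ¬ (+ 2 ∣ b) × ¬ (+ 2 ∣ c) →
      (+ 4 ∣ a → IsEpsilon Q 2 [ 2 ])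
      × ((a ≡ + 2 [mod 4 ] × a + b + c ≡ + 0 [mod 8 ])
          ⊎ (a ≡ + 2 [mod 4 ] × b + c ≡ + 0 [mod 8 ]) →
          IsEpsilon Q 2 ∞)
      × (¬ (+ 4 ∣ a)
          × ¬ ((a ≡ + 2 [mod 4 ] × a + b + c ≡ + 0 [mod 8 ])
                ⊎ (a ≡ + 2 [mod 4 ] × b + c ≡ + 0 [mod 8 ])) →
          IsEpsilon Q 2 [ 4 ])))
theorem1p5 a b c _ = odd , two
  where
  Q = diagonal a b c

  odd : ∀ (p : ℕ) (p-prime : Prime p) → p ≢ 2 → Labelled p a b c → _
  odd p p-prime p≢2 labelled = case₁ , case₂ , case-∞
    where
    open Labelled labelled

    others : #divisibleBy p (a ∷ b ∷ c ∷ []) ≡ 1 → ¬ (+ p ∣ b) × ¬ (+ p ∣ c)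
    others #≡1 = exactly-one (+ p ∣? a) (+ p ∣? b) (+ p ∣? c) #≡1 (one-divisible #≡1)

    residue? : Dec (QuadraticResidue (- (b * c)) p)
    residue? = quadraticResidue? (- (b * c)) p ⦃ prime⇒nonZero p-prime ⦄

    case₁ : #divisibleBy p (a ∷ b ∷ c ∷ []) ≡ 2 → IsEpsilon Q p [ 1 ]
    case₁ #≡2 = two-divisible p-prime p≢2 a b c
      (exactly-two (+ p ∣? a) (+ p ∣? b) (+ p ∣? c) #≡2)

    case₂ : #divisibleBy p (a ∷ b ∷ c ∷ []) ≡ 1 × legendre (- (b * c)) p p-prime ≡ -1ℤ →
            IsEpsilon Q p [ 2 ]
    case₂ (#≡1 , symbol) = let p∤b , p∤c = others #≡1 in
      isEpsilon-suc Q p 1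
        (obstructed-p² p-prime p≢2 a b c (one-divisible #≡1) p∤b
          (symbol≡-1 (+ p ∣? - (b * c)) residue? symbol))
        (universal-one-divisible p-prime p≢2 a b c p∤b p∤c)

    case-∞ : ¬ (+ p ∣ a * b * c)
             ⊎ (#divisibleBy p (a ∷ b ∷ c ∷ []) ≡ 1 × legendre (- (b * c)) p p-prime ≡ 1ℤ) →
             IsEpsilon Q p ∞
    case-∞ (inj₁ p∤abc) = isEpsilon-∞ Q (universal-unramified p-prime p≢2 a b c
      (λ p∣a → p∤abc (∣m⇒∣m*n c (∣m⇒∣m*n b p∣a)))
      (λ p∣b → p∤abc (∣m⇒∣m*n c (∣n⇒∣m*n a p∣b)))
      (λ p∣c → p∤abc (∣n⇒∣m*n (a * b) p∣c)))
    case-∞ (inj₂ (#≡1 , symbol)) = let p∤b , p∤c = others #≡1 in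
      isEpsilon-∞ Q (universal-isotropic p-prime p≢2 a b c p∤b p∤c
        (symbol≡1 (+ p ∣? - (b * c)) residue? symbol))

  two : Labelled 2 a b c → _
  two _ =
    (λ parity@(2∤a , 2∤b , 2∤c) →
      -- Each formula unfolds to the hypotheses of its case, so `parity , cond` proves it; the
      -- number given to `ε₂-finite` is ε - 1.
      (λ cond → ε₂-finite 2 (odd-odd-odd ∧ᶠ (4 ∣ᶠ 𝐚 ⊟ 𝐛 ∧ᶠ 4 ∣ᶠ 𝐛 ⊟ 𝐜)) a b c (parity , cond)) ,
      (λ cond → isEpsilon-∞ Q (universal-2^ a b c (∤2⇒∤4 a 2∤a) (∤2⇒∤4 b 2∤b) (∤2⇒∤4 c 2∤c)
        (universal-mod-16 (odd-odd-odd ∧ᶠ ¬ᶠ (4 ∣ᶠ 𝐚 ⊟ 𝐛 ∧ᶠ 4 ∣ᶠ 𝐛 ⊟ 𝐜)) a b c (parity , cond))))) ,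
    (λ parity →
      (λ cond → ε₂-finite 1 (even-even-odd ∧ᶠ 4 ∣ᶠ 𝐚 ∧ᶠ 4 ∣ᶠ 𝐛) a b c (parity , cond)) ,
      (λ cond → ε₂-finite 2 (even-even-odd ∧ᶠ ((4 ∣ᶠ 𝐚 ⊟ 𝐛 ∧ᶠ 4 ∣ᶠ 𝐛 ⊟ con (+ 2)) ∨ᶠ
                                (4 ∣ᶠ 𝐚 ⊟ con (+ 2) ∧ᶠ 8 ∣ᶠ 𝐛 ⊟ con (+ 0)))) a b c (parity , cond)) ,
      (λ cond → ε₂-finite 3 (even-even-odd ∧ᶠ 4 ∣ᶠ 𝐚 ⊟ con (+ 2) ∧ᶠ 8 ∣ᶠ 𝐛 ⊟ con (+ 4)) a b c (parity , cond))) ,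
    (λ parity@(_ , 2∤b , 2∤c) →
      (λ cond → ε₂-finite 1 (even-odd-odd ∧ᶠ 4 ∣ᶠ 𝐚) a b c (parity , cond)) ,
      -- Both alternatives contain a ≡ 2 modulo 4, which yields 4 ∤ a.
      (λ cond → isEpsilon-∞ Q (universal-2^ a b c (≡2⇒∤4 a ([ proj₁ , proj₁ ]′ cond)) (∤2⇒∤4 b 2∤b) (∤2⇒∤4 c 2∤c)
        (universal-mod-16 (even-odd-odd ∧ᶠ sum-condition) a b c (parity , cond)))) ,
      (λ cond → ε₂-finite 3 (even-odd-odd ∧ᶠ ¬ᶠ 4 ∣ᶠ 𝐚 ∧ᶠ ¬ᶠ sum-condition) a b c (parity , cond)))
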